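{- Let $K=\langle\Sigma,W,\hat w,A_1,A_2,P_1,P_2,L,\delta\rangle$ and $K'=\langle\Sigma,W',\hat w',A_1',A_2',P_1',P_2',L',\delta'\rangle$ be two ATSs. Then: (1) every successor set simulation from $K$ to $K'$ is an alternating simulation from $K$ to $K'$, and every alternating simulation from $K$ to $K'$ is a successor set simulation from $K$ to $K'$; (2) the maximum successor set simulation $\approx^*$ and the maximum alternating simulation $\preceq_{\mathsf{altsim}}$ between $K$ and $K'$ satisfy $\approx^*\;=\;\preceq_{\mathsf{altsim}}$.
   Context: In an ATS $K=\langle\Sigma,W,\hat w,A_1,A_2,P_1,P_2,L,\delta\rangle$, $\Sigma$ is a finite set of observations, $W$ a finite set of states, $\hat w\in W$ the initial state, $A_i$ a finite set of actions of Agent $i$, $P_i:W\to 2^{A_i}\setminus\{\emptyset\}$ the available actions, $L:W\to\Sigma$ a labeling, $\delta:W\times A_1\times A_2\to W$ the transition function. $S\subseteq W\times W'$ is an alternating simulation from $K$ to $K'$ if for all $(w,w')\in S$: $L(w)=L'(w')$ and $\forall a\in P_1(w)\ \exists a'\in P_1'(w')\ \forall b'\in P_2'(w')\ \exists b\in P_2(w):(\delta(w,a,b),\delta'(w',a',b'))\in S$. $\mathsf{Succ}(w,a)=\{\delta(w,a,b)\mid b\in P_2(w)\}$ for $a\in P_1(w)$, and $\mathsf{Succ}(K)=\{\mathsf{Succ}(w,a)\mid w\in W,a\in P_1(w)\}$; similarly for $K'$. A relation $\approx\;\subseteq W\times W'$ is a successor set simulation from $K$ to $K'$ if there exists a companion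 relation $\approx^S\;\subseteq\mathsf{Succ}(K')\times\mathsf{Succ}(K)$ such that: (i) for all $(w,w')\in\;\approx$, $L(w)=L'(w')$; (ii) if $(w,w')\in\;\approx$, then for all $a\in P_1(w)$ there exists $a'\in P_1'(w')$ with $(\mathsf{Succ}(w',a'),\mathsf{Succ}(w,a))\in\;\approx^S$; (iii) if $(T',T)\in\;\approx^S$, then for all $r'\in T'$ there exists $r\in T$ with $(r,r')\in\;\approx$. Both kinds of relations are closed under union; the maximum ones are denoted $\approx^*$ and $\preceq_{\mathsf{altsim}}$. -}

module Defs where

open import Data.Bool.Base using (true)
open import Data.Fin.Base using (Fin)
open import Data.Fin.Properties using (any?; _≟_)
open import Data.Fin.Subset using (Subset; _∈_; Nonempty)
open import Data.Fin.Subset.Properties using (_∈?_)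
open import Data.Nat.Base using (ℕ)
open import Data.Product.Base using (∃; ∃₂; ∃-syntax; _×_)
open import Data.Vec.Base using (tabulate)
open import Data.Vec.Properties using (lookup⇒[]=; []=⇒lookup; lookup∘tabulate)
open import Level using (Level; 0ℓ) renaming (suc to lsuc; _⊔_ to _⊔ˡ_)
open import Relation.Binary.Core using (REL; _⇒_)
open import Relation.Binary.PropositionalEquality.Core using (_≡_; sym; trans)
open import Relation.Nullary.Decidable using (Dec; yes; does; _×-dec_; dec-true)
open import Relation.Unary using (Pred; Decidable)

-- Finite sets are taken to be of the form `Fin n`.  Subsets of them that are
-- compared for equality are `Subset n`, for which `_≡_` is extensional.

⟪_⟫ : ∀ {n} {P : Pred (Fin n) 0ℓ} → Decidable P → Subset n
⟪ P? ⟫ = tabulate (λ x → does (P? x))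

∈⟪⟫⁺ : ∀ {n} {P : Pred (Fin n) 0ℓ} (P? : Decidable P) {x : Fin n} → P x → x ∈ ⟪ P? ⟫
∈⟪⟫⁺ P? {x} px =
  lookup⇒[]= x ⟪ P? ⟫ (trans (lookup∘tabulate (λ y → does (P? y)) x) (dec-true (P? x) px))

∈⟪⟫⁻ : ∀ {n} {P : Pred (Fin n) 0ℓ} (P? : Decidable P) {x : Fin n} → x ∈ ⟪ P? ⟫ → P x
∈⟪⟫⁻ {P = P} P? {x} x∈ =
  witness (P? x) (trans (sym (lookup∘tabulate (λ y → does (P? y)) x)) ([]=⇒lookup x∈))
  where
  witness : (d : Dec (P x)) → does d ≡ true → P x
  witness (yes px) _ = px

-- The parameter is the size of the set of observations, which the two systems
-- being compared share.
record ATS (∣Σ∣ : ℕ) : Set where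
  field
    ∣W∣ ∣A₁∣ ∣A₂∣ : ℕ

  W : Set
  W = Fin ∣W∣

  A₁ : Set
  A₁ = Fin ∣A₁∣

  A₂ : Set
  A₂ = Fin ∣A₂∣

  field
    ŵ           : W
    P₁          : W → Subset ∣A₁∣
    P₂          : W → Subset ∣A₂∣
    P₁-nonempty : ∀ w → Nonempty (P₁ w)
    P₂-nonempty : ∀ w → Nonempty (P₂ w)
    L           : W → Fin ∣Σ∣
    δ           : W → A₁ → A₂ → W

  IsSucc : W → A₁ → Pred W 0ℓ
  IsSucc w a v = ∃[ b ] b ∈ P₂ w × δ w a b ≡ v

  isSucc? : ∀ w a → Decidable (IsSucc w a)
  isSucc? w a v = any? (λ b → (b ∈? P₂ w) ×-dec (δ w a b ≟ v))

  -- Defined for every action a; availability of a is required in `SuccSets`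
  -- and wherever `Succ` is used.
  Succ : W → A₁ → Subset ∣W∣
  Succ w a = ⟪ isSucc? w a ⟫

  SuccSets : Pred (Subset ∣W∣) 0ℓ
  SuccSets T = ∃₂ λ w a → a ∈ P₁ w × T ≡ Succ w a

module _ {∣Σ∣ : ℕ} (K K′ : ATS ∣Σ∣) where

  private
    module K  = ATS K
    module K′ = ATS K′

  IsAlternatingSimulation : Pred (REL K.W K′.W 0ℓ) 0ℓ
  IsAlternatingSimulation S =
    ∀ {w w′} → S w w′ →
      K.L w ≡ K′.L w′ ×
      (∀ a → a ∈ K.P₁ w →
       ∃[ a′ ] a′ ∈ K′.P₁ w′ ×
       (∀ b′ → b′ ∈ K′.P₂ w′ →
        ∃[ b ] b ∈ K.P₂ w × S (K.δ w a b) (K′.δ w′ a′ b′)))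

  record IsCompanion (_≈_ : REL K.W K′.W 0ℓ)
                     (_≈ˢ_ : REL (Subset K′.∣W∣) (Subset K.∣W∣) 0ℓ) : Set where
    field
      ≈ˢ-succSets : ∀ {T′ T} → T′ ≈ˢ T → K′.SuccSets T′ × K.SuccSets T
      labels      : ∀ {w w′} → w ≈ w′ → K.L w ≡ K′.L w′
      actions     : ∀ {w w′} → w ≈ w′ → ∀ a → a ∈ K.P₁ w →
                    ∃[ a′ ] a′ ∈ K′.P₁ w′ × K′.Succ w′ a′ ≈ˢ K.Succ w a
      successors  : ∀ {T′ T} → T′ ≈ˢ T → ∀ r′ → r′ ∈ T′ →
                    ∃[ r ] r ∈ T × r ≈ r′

  IsSuccessorSetSimulation : Pred (REL K.W K′.W 0ℓ) (lsuc 0ℓ)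
  IsSuccessorSetSimulation R = ∃ (IsCompanion R)

-- Greatest element, with respect to inclusion, of a class of relations.
IsMaximum : ∀ {p : Level} {A B : Set} → Pred (REL A B 0ℓ) p → Pred (REL A B 0ℓ) (lsuc 0ℓ ⊔ˡ p)
IsMaximum 𝒞 R = 𝒞 R × (∀ {S} → 𝒞 S → S ⇒ R)

{-# OPTIONS --safe #-}

-- Succ w a is exactly the set of responses quantified over in an alternating
-- simulation, so the two notions coincide: as companion relation one takes the
-- largest one, relating T′ to T whenever every r′ ∈ T′ is simulated by some r ∈ T.
--
-- The union of all alternating simulations quantifies over relations and hence
-- lives one universe too high.  The union of the Boolean-valued simulations is
-- small, and since there are finitely many of these, it is decidable.  A
-- decidable relation may be shown to contain an arbitrary simulation S up to
-- double negation, and by finiteness it is not false that S is Boolean-valued.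

module Submission where

open import Defs
open import Data.Fin.Base using (Fin; combine; remQuot)
open import Data.Fin.Properties using (_≟_; any?; all?; sequence; remQuot-combine)
open import Data.Fin.Subset using (Subset; _∈_)
open import Data.Fin.Subset.Properties using (_∈?_; anySubset?)
open import Data.Nat.Base using (ℕ; _*_)
open import Data.Product.Base using (∃; ∃-syntax; _×_; _,_; proj₁; proj₂; map₂; uncurry)
open import Effect.Monad using (RawMonad)
open import Level using (0ℓ)
open import Relation.Binary.Core using (REL; _⇒_; _⇔_)
open import Relation.Binary.Definitions using (Decidable)
open import Relation.Binary.PropositionalEquality.Core using (_≡_; refl; sym; subst)
open import Relation.Nullary.Decidable
  using (Dec; map′; _×-dec_; _→-dec_; decidable-stable; ¬¬-excluded-middle)
open import Relation.Nullary.Negation using (DoubleNegation; ¬¬-Monad; ¬¬-map)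
import Relation.Unary as Unary

-- Excluded middle holds under double negation at each point, and double negation, being
-- applicative, commutes with products over `Fin n`.
¬¬-decidable : ∀ {n} (P : Unary.Pred (Fin n) 0ℓ) → DoubleNegation (Unary.Decidable P)
¬¬-decidable P = sequence (RawMonad.rawApplicative ¬¬-Monad) (λ _ → ¬¬-excluded-middle)

-- Pairs are coded in `Fin (m * n)` so that `anySubset?` can search all Boolean-valued relations.
⟦_⟧ : ∀ {m n} → Subset (m * n) → REL (Fin m) (Fin n) 0ℓ
⟦ B ⟧ i j = combine i j ∈ B

¬¬-boolean : ∀ {m n} (S : REL (Fin m) (Fin n) 0ℓ) →
             DoubleNegation (∃[ B ] ⟦ B ⟧ ⇔ S)
¬¬-boolean {m} {n} S = ¬¬-map boolean (¬¬-decidable S′)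
  where
  S′ : Unary.Pred (Fin (m * n)) 0ℓ
  S′ k = uncurry S (remQuot n k)

  boolean : Unary.Decidable S′ → ∃[ B ] ⟦ B ⟧ ⇔ S
  boolean S′? = ⟪ S′? ⟫
    , (λ {i} {j} ij∈B → subst (uncurry S) (remQuot-combine i j) (∈⟪⟫⁻ S′? ij∈B))
    , (λ {i} {j} s → ∈⟪⟫⁺ S′? (subst (uncurry S) (sym (remQuot-combine i j)) s))

module _ {∣Σ∣ : ℕ} (K : ATS ∣Σ∣) where
  open ATS K

  δ∈Succ : ∀ {w a b} → b ∈ P₂ w → δ w a b ∈ Succ w a
  δ∈Succ {w} {a} {b} b∈ = ∈⟪⟫⁺ (isSucc? w a) (b , b∈ , refl)

  ∈Succ⇒IsSucc : ∀ {w a v} → v ∈ Succ w a → IsSucc w a v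
  ∈Succ⇒IsSucc {w} {a} = ∈⟪⟫⁻ (isSucc? w a)

module _ {∣Σ∣ : ℕ} (K K′ : ATS ∣Σ∣) where

  private
    module K  = ATS K
    module K′ = ATS K′

  successorSet⇒alternating : ∀ (R : REL K.W K′.W 0ℓ) →
    IsSuccessorSetSimulation K K′ R → IsAlternatingSimulation K K′ R
  successorSet⇒alternating R (_ , companion) r = labels r , λ a a∈ →
    let a′ , a′∈ , succ≈succ = actions r a a∈
    in a′ , a′∈ , λ b′ b′∈ →
      let v , v∈ , v≈v′    = successors succ≈succ _ (δ∈Succ K′ b′∈)
          b , b∈ , δ≡v         = ∈Succ⇒IsSucc K v∈
      in b , b∈ , subst (λ u → R u _) (sym δ≡v) v≈v′
    where open IsCompanion companion

  alternating⇒successorSet : ∀ (R : REL K.W K′.W 0ℓ) →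
    IsAlternatingSimulation K K′ R → IsSuccessorSetSimulation K K′ R
  alternating⇒successorSet R sim = _≈ˢ_ , record
    { ≈ˢ-succSets = proj₁
    ; labels      = λ r → proj₁ (sim r)
    ; actions     = λ {w} {w′} r a a∈ →
        let a′ , a′∈ , respond = proj₂ (sim r) a a∈
        in a′ , a′∈ , ((w′ , a′ , a′∈ , refl) , (w , a , a∈ , refl)) , λ r′ r′∈ →
          let b′ , b′∈ , δ′≡r′ = ∈Succ⇒IsSucc K′ r′∈
              b  , b∈  , s     = respond b′ b′∈
          in K.δ w a b , δ∈Succ K b∈ , subst (R _) δ′≡r′ s
    ; successors  = proj₂
    }
    where
    _≈ˢ_ : REL (Subset K′.∣W∣) (Subset K.∣W∣) 0ℓ
    T′ ≈ˢ T = (K′.SuccSets T′ × K.SuccSets T) ×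
              (∀ r′ → r′ ∈ T′ → ∃[ r ] r ∈ T × R r r′)

  -- The monotone operator whose post-fixed points, `S ⇒ Matches S`, are the alternating
  -- simulations.
  Matches : REL K.W K′.W 0ℓ → REL K.W K′.W 0ℓ
  Matches S w w′ =
    K.L w ≡ K′.L w′ ×
    (∀ a → a ∈ K.P₁ w →
     ∃[ a′ ] a′ ∈ K′.P₁ w′ ×
     (∀ b′ → b′ ∈ K′.P₂ w′ →
      ∃[ b ] b ∈ K.P₂ w × S (K.δ w a b) (K′.δ w′ a′ b′)))

  matches-mono : ∀ {R S : REL K.W K′.W 0ℓ} → R ⇒ S → Matches R ⇒ Matches S
  matches-mono R⇒S = map₂ λ act a a∈ →
    map₂ (map₂ λ respond b′ b′∈ → map₂ (map₂ R⇒S) (respond b′ b′∈)) (act a a∈)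

  isAlternatingSimulation-resp-⇔ : ∀ {R S : REL K.W K′.W 0ℓ} → R ⇔ S →
    IsAlternatingSimulation K K′ S → IsAlternatingSimulation K K′ R
  isAlternatingSimulation-resp-⇔ {R} {S} (R⇒S , S⇒R) sim r =
    matches-mono {S} {R} S⇒R (sim (R⇒S r))

  isAlternatingSimulation? : ∀ {R : REL K.W K′.W 0ℓ} → Decidable R →
    Dec (IsAlternatingSimulation K K′ R)
  isAlternatingSimulation? R? = map′ (λ f {w} {w′} → f w w′) (λ f w w′ → f {w} {w′})
    (all? λ w → all? λ w′ → R? w w′ →-dec
      (K.L w ≟ K′.L w′ ×-dec
       all? λ a → a ∈? K.P₁ w →-dec
       any? λ a′ → a′ ∈? K′.P₁ w′ ×-dec
       all? λ b′ → b′ ∈? K′.P₂ w′ →-dec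
       any? λ b → b ∈? K.P₂ w ×-dec R? (K.δ w a b) (K′.δ w′ a′ b′)))

  _≼_ : REL K.W K′.W 0ℓ
  w ≼ w′ = ∃[ B ] IsAlternatingSimulation K K′ ⟦ B ⟧ × ⟦ B ⟧ w w′

  _≼?_ : Decidable _≼_
  w ≼? w′ = anySubset? λ B →
    isAlternatingSimulation? (λ v v′ → combine v v′ ∈? B) ×-dec combine w w′ ∈? B

  -- A pair in the union lies in a single `⟦ B ⟧`; the pairs reached from it stay in that `⟦ B ⟧`,
  -- hence in the union.
  ≼-isAlternatingSimulation : IsAlternatingSimulation K K′ _≼_
  ≼-isAlternatingSimulation (B , sim , wBw′) =
    matches-mono {⟦ B ⟧} {_≼_} (λ s → B , (λ {_} {_} → sim) , s) (sim wBw′)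

  ≼-greatest : ∀ {S} → IsAlternatingSimulation K K′ S → S ⇒ _≼_
  ≼-greatest {S} sim {w} {w′} s = decidable-stable (w ≼? w′)
    -- A code `B` of `S` inherits the simulation property, so it is itself a witness of `w ≼ w′`.
    (¬¬-map (λ (B , B⇔S) → B , (λ {_} {_} → isAlternatingSimulation-resp-⇔ B⇔S sim) , proj₂ B⇔S s)
            (¬¬-boolean S))

lemma4 : ∀ (∣Σ∣ : ℕ) (K K′ : ATS ∣Σ∣) →
    ((∀ (R : REL (ATS.W K) (ATS.W K′) 0ℓ) → IsSuccessorSetSimulation K K′ R → IsAlternatingSimulation K K′ R) ×
    (∀ (R : REL (ATS.W K) (ATS.W K′) 0ℓ) → IsAlternatingSimulation K K′ R → IsSuccessorSetSimulation K K′ R)) ×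
    (∃ (IsMaximum (IsSuccessorSetSimulation K K′)) ×
    ∃ (IsMaximum (IsAlternatingSimulation K K′)) ×
    (∀ (_≈*_ _≼_ : REL (ATS.W K) (ATS.W K′) 0ℓ) →
    IsMaximum (IsSuccessorSetSimulation K K′) _≈*_ →
    IsMaximum (IsAlternatingSimulation K K′) _≼_ →
    _≈*_ ⇔ _≼_))
lemma4 _ K K′ =
  (sss⇒alt , alt⇒sss) ,
  -- As the two classes coincide, the same relation is the maximum of both.
  (_≼_ K K′ , alt⇒sss _ (≼-isAlternatingSimulation K K′) ,
    λ {S} sss → ≼-greatest K K′ {S} (sss⇒alt S sss)) ,
  (_≼_ K K′ , ≼-isAlternatingSimulation K K′ , λ {S} → ≼-greatest K K′ {S}) ,
  λ _≈*_ _≼′_ (≈*-sss , ≈*-max) (≼′-alt , ≼′-max) →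
    -- Each maximum belongs to the other class, so each is contained in the other.
    ≼′-max (sss⇒alt _≈*_ ≈*-sss) , ≈*-max (alt⇒sss _≼′_ ≼′-alt)
  where
  sss⇒alt = successorSet⇒alternating K K′
  alt⇒sss = alternating⇒successorSet K K′
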